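{- For all integers $w\geq0$, $k\geq1$ and $p\geq p_{w,k}$, the graph $G^{k}_{w,p}$ contains every graph with at most $\gamma(w,p)$ vertices and treewidth at most $k$.
   Context: For integers $w,p\geq0$ and $k\geq1$ define $\alpha(w,p)=\frac{1}{1+(2/3)^{w}}\Big(\frac{2+(2/3)^{w}}{1+(2/3)^{w}}\Big)^{p-1}$, $\gamma(w,p)=\Big(\frac{2+(2/3)^{w}}{1+(2/3)^{w}}\Big)^{p}$, $\beta_k(w)=(2k+4)(\frac{3}{2})^{w}$ and $\delta_k(w)=(2+(\frac{2}{3})^{w})\beta_k(w)$. Let $p_{w,k}$ be the smallest integer such that $\alpha(w,p_{w,k}+1)\geq\beta_k(w)$. For $p\geq p_{w,k}$ define $G^{k}_{w,p}$ recursively: $G^{k}_{w,p_{w,k}}$ is the complete graph $K_{\lceil\delta_k(w)\rceil}$, and for $p\geq p_{w,k}+1$, $G^{k}_{w,p}$ is obtained from a complete graph $K_{(k+1)(w+1)}$ and two disjoint copies of $G^{k}_{w,p-1}$ by adding all edges between the vertices of $K_{(k+1)(w+1)}$ and the vertices of the two copies. A graph $U$ contains a graph $H$ if some subgraph of $U$ is isomorphic to $H$. Treewidth is the usual notion. -}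

module Defs where

open import Data.Nat as ℕ using (ℕ; zero; suc; _∸_)
open import Data.Integer as ℤ using (ℤ; +_)
open import Data.Rational as ℚ using (ℚ; 1ℚ; _/_; Positive; NonZero; 1/_; ceiling)
open import Data.Rational.Properties using (pos*pos⇒pos; pos+pos⇒pos; pos⇒nonZero)
open import Data.Fin using (Fin; zero; suc; inject₁; fromℕ; splitAt)
open import Data.Fin.Subset using (Subset; _∈_; ∣_∣)
open import Data.Sum using (_⊎_; inj₁; inj₂)
open import Data.Product using (Σ; ∃; _×_; _,_)
open import Data.Unit using (⊤; tt)
open import Data.Empty using (⊥)
open import Relation.Nullary using (¬_)
open import Relation.Binary.PropositionalEquality using (_≡_; _≢_; refl; sym)
open import Function.Definitions using (Injective)

_^ℚ_ : ℚ → ℕ → ℚ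
q ^ℚ zero  = 1ℚ
q ^ℚ suc n = q ℚ.* (q ^ℚ n)

twoThirds threeHalves : ℚ
twoThirds   = + 2 / 3
threeHalves = + 3 / 2

t : ℕ → ℚ
t w = twoThirds ^ℚ w

t-pos : ∀ w → Positive (t w)
t-pos zero    = _
t-pos (suc w) = pos*pos⇒pos twoThirds {{_}} (t w) {{t-pos w}}

onePlusT-pos : ∀ w → Positive (1ℚ ℚ.+ t w)
onePlusT-pos w = pos+pos⇒pos 1ℚ {{_}} (t w) {{t-pos w}}

onePlusT-nonZero : ∀ w → NonZero (1ℚ ℚ.+ t w)
onePlusT-nonZero w = pos⇒nonZero (1ℚ ℚ.+ t w) {{onePlusT-pos w}}

ratio : ℕ → ℚ
ratio w = (((+ 2 / 1) ℚ.+ t w) ℚ.÷ (1ℚ ℚ.+ t w)) {{onePlusT-nonZero w}}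

-- alphaSuc w q = α(w, q+1) = 1/(1+(2/3)^w) * R^q
-- (α(w,p) is only ever used at p = p_{w,k}+1 ≥ 1)
alphaSuc : ℕ → ℕ → ℚ
alphaSuc w q = ((1/ (1ℚ ℚ.+ t w)) {{onePlusT-nonZero w}}) ℚ.* (ratio w ^ℚ q)

gamma : ℕ → ℕ → ℚ
gamma w p = ratio w ^ℚ p

beta : ℕ → ℕ → ℚ
beta k w = (+ (2 ℕ.* k ℕ.+ 4) / 1) ℚ.* (threeHalves ^ℚ w)

delta : ℕ → ℕ → ℚ
delta k w = ((+ 2 / 1) ℚ.+ t w) ℚ.* beta k w

-- ⌈δ_k(w)⌉ as a natural number (δ_k(w) > 0)
ceilDelta : ℕ → ℕ → ℕ
ceilDelta k w = ℤ.∣ ceiling (delta k w) ∣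

toℚ : ℕ → ℚ
toℚ n = + n / 1

IsPwk : ℕ → ℕ → ℕ → Set
IsPwk w k p = (beta k w ℚ.≤ alphaSuc w p)
            × (∀ q → q ℕ.< p → alphaSuc w q ℚ.< beta k w)

record Graph : Set₁ where
  field
    n      : ℕ
    Adj    : Fin n → Fin n → Set
    symm   : ∀ {u v} → Adj u v → Adj v u
    irrefl : ∀ {u} → ¬ Adj u u
open Graph public

K : ℕ → Graph
K m = record { n = m ; Adj = λ u v → u ≢ v
             ; symm = λ u≢v v≡u → u≢v (sym v≡u)
             ; irrefl = λ u≢u → u≢u refl }

data Part (c m : ℕ) : Set where
  clique : Fin c → Part c m
  left   : Fin m → Part c m
  right  : Fin m → Part c m

part : ∀ c m → Fin (c ℕ.+ (m ℕ.+ m)) → Part c m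
part c m u with splitAt c u
... | inj₁ i = clique i
... | inj₂ j with splitAt m j
...   | inj₁ x = left x
...   | inj₂ y = right y

module _ (c : ℕ) (G : Graph) where
  private m = n G
  PAdj : Part c m → Part c m → Set
  PAdj (clique i) (clique j) = i ≢ j
  PAdj (clique _) (left _)   = ⊤
  PAdj (clique _) (right _)  = ⊤
  PAdj (left _)   (clique _) = ⊤
  PAdj (right _)  (clique _) = ⊤
  PAdj (left x)   (left y)   = Adj G x y
  PAdj (right x)  (right y)  = Adj G x y
  PAdj (left _)   (right _)  = ⊥
  PAdj (right _)  (left _)   = ⊥

  PAdj-sym : ∀ a b → PAdj a b → PAdj b a
  PAdj-sym (clique i) (clique j) e = λ j≡i → e (sym j≡i)
  PAdj-sym (clique _) (left _)   e = tt
  PAdj-sym (clique _) (right _)  e = tt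
  PAdj-sym (left _)   (clique _) e = tt
  PAdj-sym (right _)  (clique _) e = tt
  PAdj-sym (left x)   (left y)   e = symm G e
  PAdj-sym (right x)  (right y)  e = symm G e

  PAdj-irr : ∀ a → ¬ PAdj a a
  PAdj-irr (clique i) e = e refl
  PAdj-irr (left x)   e = irrefl G e
  PAdj-irr (right x)  e = irrefl G e

  joinK2 : Graph
  joinK2 = record
    { n = c ℕ.+ (m ℕ.+ m)
    ; Adj = λ u v → PAdj (part c m u) (part c m v)
    ; symm = λ {u} {v} → PAdj-sym (part c m u) (part c m v)
    ; irrefl = λ {u} → PAdj-irr (part c m u) }

-- Gseq w k i = G^k_{w, p_{w,k} + i}
Gseq : ℕ → ℕ → ℕ → Graph
Gseq w k zero    = K (ceilDelta k w)
Gseq w k (suc i) = joinK2 (suc k ℕ.* suc w) (Gseq w k i)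

-- G^k_{w,p} for p ≥ p_{w,k} (given p_{w,k} = pwk)
Gwkp : (w k pwk p : ℕ) → Graph
Gwkp w k pwk p = Gseq w k (p ∸ pwk)

-- Containment: U contains H iff some subgraph of U is isomorphic to H,
-- i.e. there is an injective edge-preserving map V(H) → V(U).

Contains : Graph → Graph → Set
Contains U H = Σ (Fin (n H) → Fin (n U)) λ f →
  Injective _≡_ _≡_ f × (∀ u v → Adj H u v → Adj U (f u) (f v))

data WalkWithin (G : Graph) (P : Fin (n G) → Set) : Fin (n G) → Fin (n G) → Set where
  here : ∀ {u} → P u → WalkWithin G P u u
  step : ∀ {u w v} → P u → Adj G u w → WalkWithin G P w v → WalkWithin G P u v

Connected : Graph → Set
Connected G = ∀ u v → WalkWithin G (λ _ → ⊤) u v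

HasCycle : Graph → Set
HasCycle G = Σ ℕ λ l → Σ (Fin (3 ℕ.+ l) → Fin (n G)) λ c →
  Injective _≡_ _≡_ c
  × (∀ (i : Fin (2 ℕ.+ l)) → Adj G (c (inject₁ i)) (c (suc i)))
  × Adj G (c (fromℕ (2 ℕ.+ l))) (c zero)

IsTree : Graph → Set
IsTree T = (1 ℕ.≤ n T) × Connected T × ¬ HasCycle T

record TreeDecomposition (H : Graph) (k : ℕ) : Set₁ where
  field
    tree      : Graph
    isTree    : IsTree tree
    bag       : Fin (n tree) → Subset (n H)
    bagSize   : ∀ x → ∣ bag x ∣ ℕ.≤ suc k
    vertexCov : ∀ v → ∃ λ x → v ∈ bag x
    edgeCov   : ∀ u v → Adj H u v → ∃ λ x → (u ∈ bag x) × (v ∈ bag x)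
    coherent  : ∀ v x y → v ∈ bag x → v ∈ bag y →
                WalkWithin tree (λ z → v ∈ bag z) x y

TreewidthAtMost : Graph → ℕ → Set₁
TreewidthAtMost H k = TreeDecomposition H k

{-# OPTIONS --safe #-}
module Submission where

-- Induction on p: a vertex set S of size at most γ(w, p+1) is cut by w + 1 bags
-- into two sides of size at most γ(w, p) with no edge between them.  The bags
-- go to the clique, the sides to the two copies.
--
-- The cut starts from the sides S, ∅ and is improved one bag at a time.  If the
-- larger side A has 2|A| ≤ |S| + 3e + 2 and e ≥ k + 1, then one bag detaches
-- from A a piece M with 2|A| − |S| − e ≤ 2|M| ≤ 2|A| − |S| + e, and moving M to
-- the other side leaves both sides with 2|·| ≤ |S| + e.  Thus w + 1 bags suffice
-- as soon as |S| < 3^(w+1) (e + 1), and e = ⌊2 γ(w, p) − γ(w, p+1)⌋ satisfies this.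
--
-- The piece M is found by contracting the decomposition tree leaf by leaf until
-- the vertices collected below some node enter the prescribed window.

open import Defs

-- Rational estimates for α, β, γ and δ.

module Estimates where

  open import Data.Nat as ℕ using (ℕ; zero; suc)
  import Data.Nat.Properties as ℕ
  import Data.Nat.DivMod as ℕ
  import Data.Nat.Coprimality as Coprime
  open import Data.Integer as ℤ using (+_)
  import Data.Integer.Properties as ℤ
  import Data.Integer.DivMod as ℤ
  open import Data.Rational as ℚ
    using (ℚ; mkℚ; 0ℚ; 1ℚ; 1/_; _+_; _*_; _≤_; _<_; *≤*; *<*; ↥_; ↧_; floor; ceiling)
  open import Data.Rational.Properties
  open import Data.Rational.Solver using (module +-*-Solver)
  open +-*-Solver using (solve; _:=_; _:+_; _:*_; con)
  open import Data.Product using (∃-syntax; _×_; _,_)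
  open import Data.Unit using (tt)
  open import Relation.Binary.PropositionalEquality
    using (_≡_; refl; sym; trans; cong; cong₂; subst; subst₂)

  -- `+ n / 1` normalises through a gcd that is stuck on a variable `n`; the right-hand side exposes
  -- numerator and denominator.
  toℚ≡ : ∀ n → toℚ n ≡ mkℚ (+ n) 0 (Coprime.sym (Coprime.1-coprimeTo n))
  toℚ≡ n = normalize-coprime (Coprime.sym (Coprime.1-coprimeTo n))

  toℚ-mono-≤ : ∀ m n → m ℕ.≤ n → toℚ m ≤ toℚ n
  toℚ-mono-≤ m n m≤n rewrite toℚ≡ m | toℚ≡ n = *≤* (ℤ.*-monoʳ-≤-nonNeg (+ 1) (ℤ.+≤+ m≤n))

  toℚ-cancel-< : ∀ m n → toℚ m < toℚ n → m ℕ.< n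
  toℚ-cancel-< m n m<n = ℕ.≰⇒> (λ n≤m → <-irrefl refl (<-≤-trans m<n (toℚ-mono-≤ n m n≤m)))

  toℚ-+ : ∀ m n → toℚ (m ℕ.+ n) ≡ toℚ m + toℚ n
  toℚ-+ m n rewrite toℚ≡ m | toℚ≡ n =
    cong (ℚ._/ 1) (sym (cong₂ ℤ._+_ (ℤ.*-identityʳ (+ m)) (ℤ.*-identityʳ (+ n))))

  toℚ-* : ∀ m n → toℚ (m ℕ.* n) ≡ toℚ m * toℚ n
  toℚ-* m n rewrite toℚ≡ m | toℚ≡ n = cong (ℚ._/ 1) (ℤ.pos-* m n)

  0≤toℚ : ∀ n → 0ℚ ≤ toℚ n
  0≤toℚ n = toℚ-mono-≤ 0 n ℕ.z≤n

  *-monoˡ : ∀ {r p q} → 0ℚ ≤ r → p ≤ q → r * p ≤ r * q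
  *-monoˡ {r} 0≤r = *-monoˡ-≤-nonNeg r {{ℚ.nonNegative 0≤r}}

  *-monoʳ : ∀ {r p q} → 0ℚ ≤ r → p ≤ q → p * r ≤ q * r
  *-monoʳ {r} 0≤r = *-monoʳ-≤-nonNeg r {{ℚ.nonNegative 0≤r}}

  0≤p*q : ∀ {p q} → 0ℚ ≤ p → 0ℚ ≤ q → 0ℚ ≤ p * q
  0≤p*q {p} 0≤p 0≤q = subst (_≤ p * _) (*-zeroʳ p) (*-monoˡ 0≤p 0≤q)

  p≤p+q : ∀ {p q} → 0ℚ ≤ q → p ≤ p + q
  p≤p+q {p} 0≤q = subst (_≤ p + _) (+-identityʳ p) (+-monoʳ-≤ p 0≤q)

  0≤⇒floor : ∀ q → 0ℚ ≤ q → ∃[ e ] toℚ e ≤ q × q < toℚ (suc e)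
  0≤⇒floor (mkℚ ℤ.-[1+ _ ] _ _) (*≤* ())
  0≤⇒floor q@(mkℚ (+ a) d-1 _) _ = e , lower , upper
    where
    d = suc d-1
    e = a ℕ./ d
    lower : toℚ e ≤ q
    lower rewrite toℚ≡ e = *≤* (subst₂ ℤ._≤_ (ℤ.pos-* e d) (sym (ℤ.*-identityʳ (+ a)))
      (ℤ.+≤+ (ℕ.m/n*n≤m a d)))
    upper : q < toℚ (suc e)
    upper rewrite toℚ≡ (suc e) = *<* (subst₂ ℤ._<_ (sym (ℤ.*-identityʳ (+ a))) (ℤ.pos-* (suc e) d)
      (ℤ.+<+ (subst (ℕ._< suc e ℕ.* d) (sym (ℕ.m≡m%n+[m/n]*n a d))
        (ℕ.+-monoˡ-< (e ℕ.* d) (ℕ.m%n<n a d)))))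

  floor*↧≤↥ : ∀ p → floor p ℤ.* ↧ p ℤ.≤ ↥ p
  floor*↧≤↥ p@record{} = ℤ.[n/d]*d≤n (↥ p) (↧ p)

  ceiling≡-floor- : ∀ p → ceiling p ≡ ℤ.- floor (ℚ.- p)
  ceiling≡-floor- record{} = refl

  -- The ceiling of q is -⌊-q⌋, so it is enough that ⌊-q⌋ ≤ -s, which is checked after multiplying
  -- by the denominator of q.
  toℚ≤⇒≤∣ceiling∣ : ∀ {s q} → toℚ s ≤ q → s ℕ.≤ ℤ.∣ ceiling q ∣
  toℚ≤⇒≤∣ceiling∣ {s} {q} s≤q = ℤ.drop‿+≤+ (subst (+ s ℤ.≤_)
    (sym (ℤ.0≤i⇒+∣i∣≡i (ℤ.≤-trans (ℤ.+≤+ ℕ.z≤n) s≤⌈q⌉))) s≤⌈q⌉)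
    where
    z = floor (ℚ.- q)
    s*↧≤↥ : + s ℤ.* ↧ q ℤ.≤ ↥ q
    s*↧≤↥ = subst (+ s ℤ.* ↧ q ℤ.≤_) (ℤ.*-identityʳ (↥ q))
      (drop-*≤* (subst (_≤ q) (toℚ≡ s) s≤q))
    z*↧≤-s*↧ : z ℤ.* ↧ q ℤ.≤ (ℤ.- + s) ℤ.* ↧ q
    z*↧≤-s*↧ = ℤ.≤-trans
      (subst₂ (λ d m → z ℤ.* d ℤ.≤ m) (↧-neg q) (↥-neg q) (floor*↧≤↥ (ℚ.- q)))
      (ℤ.≤-trans (ℤ.neg-mono-≤ s*↧≤↥) (ℤ.≤-reflexive (ℤ.neg-distribˡ-* (+ s) (↧ q))))
    s≤⌈q⌉ : + s ℤ.≤ ceiling q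
    s≤⌈q⌉ = subst₂ ℤ._≤_ (ℤ.neg-involutive (+ s)) (sym (ceiling≡-floor- q))
      (ℤ.neg-mono-≤ (ℤ.*-cancelʳ-≤-pos z (ℤ.- + s) (↧ q) z*↧≤-s*↧))

  0≤t : ∀ w → 0ℚ ≤ t w
  0≤t w = <⇒≤ (positive⁻¹ (t w) {{t-pos w}})

  t≤1 : ∀ w → t w ≤ 1ℚ
  t≤1 zero    = ≤-refl
  t≤1 (suc w) = ≤-trans (*-monoˡ-≤-nonNeg twoThirds (t≤1 w)) (≤ᵇ⇒≤ {twoThirds * 1ℚ} {1ℚ} tt)

  t*threeHalves : ∀ w → t w * (threeHalves ^ℚ w) ≡ 1ℚ
  t*threeHalves zero    = refl
  t*threeHalves (suc w) = trans
    (solve 4 (λ a x b y → (a :* x) :* (b :* y) := (a :* b) :* (x :* y)) refl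
      twoThirds (t w) threeHalves (threeHalves ^ℚ w))
    (cong ((twoThirds * threeHalves) *_) (t*threeHalves w))

  -- The product is 2^w: each step doubles it.
  3^w*t≥1 : ∀ w → 1ℚ ≤ toℚ (3 ℕ.^ w) * t w
  3^w*t≥1 zero    = ≤-refl
  3^w*t≥1 (suc w) = begin
    1ℚ                                           ≤⟨ 3^w*t≥1 w ⟩
    g                                            ≤⟨ p≤p+q (0≤p*q (0≤toℚ (3 ℕ.^ w)) (0≤t w)) ⟩
    g + g                                        ≡⟨ regroup ⟩
    toℚ 3 * toℚ (3 ℕ.^ w) * (twoThirds * t w)    ≡⟨ cong (_* t (suc w)) (toℚ-* 3 (3 ℕ.^ w)) ⟨
    toℚ (3 ℕ.^ suc w) * t (suc w)                ∎
    where
    open ≤-Reasoning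
    g = toℚ (3 ℕ.^ w) * t w
    regroup : g + g ≡ toℚ 3 * toℚ (3 ℕ.^ w) * (twoThirds * t w)
    regroup = solve 2 (λ a x → a :* x :+ a :* x := con (toℚ 3) :* a :* (con twoThirds :* x)) refl
      (toℚ (3 ℕ.^ w)) (t w)

  module Weights (w k : ℕ) where

    private
      x u R : ℚ
      x = t w
      u = (1/ (1ℚ + x)) {{onePlusT-nonZero w}}
      R = ratio w
      c = 2 ℕ.* k ℕ.+ 4

    open ≤-Reasoning

    0≤u : 0ℚ ≤ u
    0≤u = <⇒≤ (positive⁻¹ u {{1/pos⇒pos (1ℚ + x) {{onePlusT-pos w}}}})

    [1+x]u≡1 : (1ℚ + x) * u ≡ 1ℚ
    [1+x]u≡1 = *-inverseʳ (1ℚ + x) {{onePlusT-nonZero w}}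

    ratio≡1+u : R ≡ 1ℚ + u
    ratio≡1+u = begin-equality
      (toℚ 2 + x) * u      ≡⟨ solve 2 (λ x u → (con (toℚ 2) :+ x) :* u := (con 1ℚ :+ x) :* u :+ u) refl x u ⟩
      (1ℚ + x) * u + u     ≡⟨ cong (_+ u) [1+x]u≡1 ⟩
      1ℚ + u               ∎

    0≤ratio : 0ℚ ≤ R
    0≤ratio = subst (0ℚ ≤_) (sym ratio≡1+u) (≤-trans (0≤toℚ 1) (p≤p+q 0≤u))

    0≤gamma : ∀ p → 0ℚ ≤ gamma w p
    0≤gamma zero    = 0≤toℚ 1
    0≤gamma (suc p) = 0≤p*q 0≤ratio (0≤gamma p)

    0≤alphaSuc : ∀ p → 0ℚ ≤ alphaSuc w p
    0≤alphaSuc p = 0≤p*q 0≤u (0≤gamma p)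

    gamma-suc : ∀ p → gamma w (suc p) ≡ (toℚ 2 + x) * alphaSuc w p
    gamma-suc p = *-assoc (toℚ 2 + x) u (gamma w p)

    gamma-step : ∀ p → gamma w p ≤ gamma w (suc p)
    gamma-step p = begin
      gamma w p                       ≤⟨ p≤p+q (0≤alphaSuc p) ⟩
      gamma w p + u * gamma w p       ≡⟨ solve 2 (λ u g → g :+ u :* g := (con 1ℚ :+ u) :* g) refl u (gamma w p) ⟩
      (1ℚ + u) * gamma w p            ≡⟨ cong (_* gamma w p) ratio≡1+u ⟨
      R * gamma w p                   ∎

    alphaSuc-mono : ∀ {p} i → alphaSuc w p ≤ alphaSuc w (i ℕ.+ p)
    alphaSuc-mono     zero    = ≤-refl
    alphaSuc-mono {p} (suc i) = ≤-trans (alphaSuc-mono i) (*-monoˡ 0≤u (gamma-step (i ℕ.+ p)))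

    -- The powers of 2/3 and 3/2 cancel. Hence β ≤ α(w, p+1) gives 2k + 4 ≤ t(w) α(w, p+1), which
    -- makes the slack e at least the bag size k + 1.
    t*beta : x * beta k w ≡ toℚ c
    t*beta = begin-equality
      x * (toℚ c * h)    ≡⟨ solve 3 (λ a b c → a :* (b :* c) := b :* (a :* c)) refl x (toℚ c) h ⟩
      toℚ c * (x * h)    ≡⟨ cong (toℚ c *_) (t*threeHalves w) ⟩
      toℚ c * 1ℚ         ≡⟨ *-identityʳ (toℚ c) ⟩
      toℚ c              ∎
      where h = threeHalves ^ℚ w

    0≤beta : 0ℚ ≤ beta k w
    0≤beta = *-cancelˡ-≤-pos x {{t-pos w}}
      (subst₂ _≤_ (sym (*-zeroʳ x)) (sym t*beta) (0≤toℚ c))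

    1≤delta : 1ℚ ≤ delta k w
    1≤delta = begin
      toℚ 1                             ≤⟨ toℚ-mono-≤ 1 c (ℕ.≤-trans (ℕ.s≤s ℕ.z≤n) (ℕ.m≤n+m 4 (2 ℕ.* k))) ⟩
      toℚ c                             ≡⟨ t*beta ⟨
      x * beta k w                      ≤⟨ p≤p+q (0≤p*q (0≤toℚ 2) 0≤beta) ⟩
      x * beta k w + toℚ 2 * beta k w   ≡⟨ solve 2 (λ x b → x :* b :+ con (toℚ 2) :* b := (con (toℚ 2) :+ x) :* b) refl x (beta k w) ⟩
      delta k w                         ∎

    -- Minimality of `pwk` gives α(w, pwk) < β, and multiplying by 2 + t(w) turns this into γ(w,
    -- pwk) < δ. For `pwk` = 0 there is no smaller index, and γ(w, 0) = 1 ≤ δ is used instead.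
    base-size : ∀ {pwk s} → IsPwk w k pwk → toℚ s ≤ gamma w pwk → s ℕ.≤ ceilDelta k w
    base-size {zero} _ s≤ = toℚ≤⇒≤∣ceiling∣ (≤-trans s≤ 1≤delta)
    base-size {suc q} {s} (_ , below) s≤ = toℚ≤⇒≤∣ceiling∣ (begin
      toℚ s                           ≤⟨ s≤ ⟩
      gamma w (suc q)                 ≡⟨ gamma-suc q ⟩
      (toℚ 2 + x) * alphaSuc w q      ≤⟨ *-monoˡ (≤-trans (0≤toℚ 2) (p≤p+q (0≤t w))) (<⇒≤ (below q (ℕ.n<1+n q))) ⟩
      delta k w                       ∎)

    module _ {p s e : ℕ} (beta≤ : beta k w ≤ alphaSuc w p) (s≤ : toℚ s ≤ gamma w (suc p))
      (e≤ : toℚ e ≤ t w * alphaSuc w p) (<1+e : t w * alphaSuc w p < toℚ (suc e)) where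

      private
        α g T : ℚ
        α = alphaSuc w p
        g = gamma w p
        T = x * α

      k<floor : suc k ℕ.≤ e
      k<floor = ℕ.s≤s⁻¹ (toℚ-cancel-< (suc k) (suc e) (begin-strict
        toℚ (suc k)      ≤⟨ toℚ-mono-≤ (suc k) c (ℕ.≤-trans (ℕ.≤-reflexive (ℕ.+-comm 1 k)) (ℕ.+-mono-≤ (ℕ.m≤n*m k 2) (ℕ.s≤s ℕ.z≤n))) ⟩
        toℚ c            ≡⟨ t*beta ⟨
        x * beta k w     ≤⟨ *-monoˡ (0≤t w) beta≤ ⟩
        T                <⟨ <1+e ⟩
        toℚ (suc e)      ∎))

      -- γ(w, p+1) = (2 + x) α ≤ 3 α ≤ 3^(w+1) x α, and x α < e + 1.
      size<3^[1+w]*floor : s ℕ.< 3 ℕ.^ suc w ℕ.* suc e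
      size<3^[1+w]*floor = toℚ-cancel-< s (3 ℕ.^ suc w ℕ.* suc e) (begin-strict
        toℚ s                               ≤⟨ s≤ ⟩
        gamma w (suc p)                     ≡⟨ gamma-suc p ⟩
        (toℚ 2 + x) * α                     ≤⟨ *-monoʳ (0≤alphaSuc p) (+-monoʳ-≤ (toℚ 2) (t≤1 w)) ⟩
        toℚ 3 * α                           ≡⟨ cong (toℚ 3 *_) (*-identityˡ α) ⟨
        toℚ 3 * (1ℚ * α)                    ≤⟨ *-monoˡ (0≤toℚ 3) (*-monoʳ (0≤alphaSuc p) (3^w*t≥1 w)) ⟩
        toℚ 3 * (toℚ (3 ℕ.^ w) * x * α)     ≡⟨ solve 4 (λ a b c d → a :* (b :* c :* d) := a :* b :* (c :* d)) refl (toℚ 3) (toℚ (3 ℕ.^ w)) x α ⟩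
        toℚ 3 * toℚ (3 ℕ.^ w) * T           ≡⟨ cong (_* T) (toℚ-* 3 (3 ℕ.^ w)) ⟨
        toℚ (3 ℕ.^ suc w) * T               <⟨ *-monoʳ-<-pos (toℚ (3 ℕ.^ suc w)) {{normalize-pos (3 ℕ.^ suc w) 1 {{_}} {{ℕ.m^n≢0 3 (suc w)}}}} <1+e ⟩
        toℚ (3 ℕ.^ suc w) * toℚ (suc e)     ≡⟨ toℚ-* (3 ℕ.^ suc w) (suc e) ⟨
        toℚ (3 ℕ.^ suc w ℕ.* suc e)         ∎)

      -- Since α = u g and (1 + x) u = 1, the sum γ(w, p+1) + T = (2 + x) α + x α equals 2 g.
      half≤gamma : ∀ a → 2 ℕ.* a ℕ.≤ s ℕ.+ e → toℚ a ≤ gamma w p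
      half≤gamma a 2a≤ = *-cancelˡ-≤-pos (toℚ 2) (begin
        toℚ 2 * toℚ a                ≡⟨ toℚ-* 2 a ⟨
        toℚ (2 ℕ.* a)                ≤⟨ toℚ-mono-≤ (2 ℕ.* a) (s ℕ.+ e) 2a≤ ⟩
        toℚ (s ℕ.+ e)                ≡⟨ toℚ-+ s e ⟩
        toℚ s + toℚ e                ≤⟨ +-mono-≤ s≤ e≤ ⟩
        gamma w (suc p) + T          ≡⟨ cong (_+ T) (gamma-suc p) ⟩
        (toℚ 2 + x) * α + T          ≡⟨ solve 3 (λ x u g → (con (toℚ 2) :+ x) :* (u :* g) :+ x :* (u :* g) := con (toℚ 2) :* ((con 1ℚ :+ x) :* u :* g)) refl x u g ⟩
        toℚ 2 * ((1ℚ + x) * u * g)   ≡⟨ cong (λ z → toℚ 2 * (z * g)) [1+x]u≡1 ⟩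
        toℚ 2 * (1ℚ * g)             ≡⟨ cong (toℚ 2 *_) (*-identityˡ g) ⟩
        toℚ 2 * g                    ∎)

    -- The slack e is the floor of t(w) α(w, p+1) = 2 γ(w, p) − γ(w, p+1).
    split-size : ∀ {pwk s} i → IsPwk w k pwk → toℚ s ≤ gamma w (suc (i ℕ.+ pwk)) →
      ∃[ e ] suc k ℕ.≤ e × s ℕ.< 3 ℕ.^ suc w ℕ.* suc e
           × (∀ a → 2 ℕ.* a ℕ.≤ s ℕ.+ e → toℚ a ≤ gamma w (i ℕ.+ pwk))
    split-size {pwk} {s} i (beta≤ , _) s≤
      with 0≤⇒floor (t w * alphaSuc w (i ℕ.+ pwk)) (0≤p*q (0≤t w) (0≤alphaSuc (i ℕ.+ pwk)))
    ... | e , e≤ , <1+e = e , k<floor {i ℕ.+ pwk} {s} {e} b≤ s≤ e≤ <1+e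
                            , size<3^[1+w]*floor {i ℕ.+ pwk} {s} {e} b≤ s≤ e≤ <1+e
                            , half≤gamma {i ℕ.+ pwk} {s} {e} b≤ s≤ e≤ <1+e
      where
      b≤ = ≤-trans beta≤ (alphaSuc-mono i)

import Data.Rational
open import Data.Nat
  using (ℕ; zero; suc; _+_; _*_; _∸_; _^_; _≤_; _<_; z≤n; s≤s; s≤s⁻¹)
open import Data.Nat.Properties hiding (suc-injective)
open import Data.Nat.Tactic.RingSolver using (solve-∀)
open import Data.Bool using (true; false)
open import Data.Vec using ([]; _∷_; here; there)
open import Data.Fin using (Fin; zero; suc; inject₁; fromℕ; fromℕ<; _↑ˡ_; _↑ʳ_)
open import Data.Fin.Properties using (any?; suc-injective; splitAt-↑ˡ; splitAt-↑ʳ)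
  renaming (_≟_ to _≟F_)
open import Data.Fin.Subset using (Subset; ∣_∣; _∩_; _∪_; ∁; _⊆_)
  renaming (_∈_ to _∈ˢ_; _∉_ to _∉ˢ_; ⊥ to ∅; ⊤ to full)
open import Data.Fin.Subset.Properties
  using (_∈?_; p⊆q⇒∣p∣≤∣q∣; x∈p∩q⁺; x∈p∩q⁻; x∈p∪q⁺; x∈p∪q⁻; ∣⊥∣≡0; ∉⊥; ∈⊤; ∣⊤∣≡n;
         x∈∁p⇒x∉p; x∉p⇒x∈∁p; p⊆p∪q; q⊆p∪q)
open import Data.List using (List; []; _∷_; allFin)
open import Data.List.Membership.Propositional using (_∈_; _∉_)
open import Data.List.Membership.Propositional.Properties using (∈-allFin)
import Data.List.Membership.DecPropositional as DecMembership
open import Data.List.Relation.Unary.Any using (here; there)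
open import Data.List.Relation.Unary.All as All using (All; []; _∷_)
open import Data.Product using (∃; ∃-syntax; _×_; _,_; proj₁; proj₂)
open import Data.Sum using (_⊎_; inj₁; inj₂; [_,_]′)
open import Data.Unit using (⊤; tt)
open import Data.Empty using (⊥-elim)
open import Relation.Nullary using (¬_; Dec; yes; no)
open import Relation.Binary.PropositionalEquality
  using (_≡_; _≢_; refl; sym; trans; cong; subst; subst₂)

-- Walks, simple paths and cycles.

module Walks (G : Graph) where

  private
    V = Fin (n G)
    variable
      P Q : V → Set
      u v x : V

  mapWalk : (∀ {z} → P z → Q z) → WalkWithin G P u v → WalkWithin G Q u v
  mapWalk f (here p)     = here (f p)
  mapWalk f (step p e w) = step (f p) e (mapWalk f w)

  _++ʷ_ : WalkWithin G P u v → WalkWithin G P v x → WalkWithin G P u x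
  here _     ++ʷ w′ = w′
  step p e w ++ʷ w′ = step p e (w ++ʷ w′)

  untilFirst : ∀ a → u ≢ a → WalkWithin G P u a →
    ∃[ c ] Adj G c a × P c × WalkWithin G (λ z → P z × z ≢ a) u c
  untilFirst a u≢a (here _) = ⊥-elim (u≢a refl)
  untilFirst a u≢a (step {w = w} p e wk) with w ≟F a
  ... | yes refl = _ , e , p , here (p , u≢a)
  ... | no w≢a with untilFirst a w≢a wk
  ...   | c , c~a , pc , wk′ = c , c~a , pc , step (p , u≢a) e wk′

  -- A simple path, given as an injective sequence like the cycles of `HasCycle`, so that prefixing
  -- one vertex can produce such a cycle.
  record PathOf (P : V → Set) (u v : V) : Set where
    field
      len       : ℕ
      at        : Fin (suc len) → V
      start     : at zero ≡ u
      end       : at (fromℕ len) ≡ v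
      injective : ∀ {i j} → at i ≡ at j → i ≡ j
      edges     : ∀ i → Adj G (at (inject₁ i)) (at (suc i))
      within    : ∀ i → P (at i)

  open PathOf

  suffix : (p : PathOf P u v) (i : Fin (suc (len p))) → PathOf P (at p i) v
  suffix p zero = subst (λ z → PathOf _ z _) (sym (start p)) p
  suffix record { len = suc l ; at = f ; end = e ; injective = inj ; edges = es ; within = ps } (suc i) =
    suffix (record { len = l ; at = λ j → f (suc j) ; start = refl ; end = e
                   ; injective = λ eq → suc-injective (inj eq)
                   ; edges = λ j → es (suc j) ; within = λ j → ps (suc j) }) i

  cons : P u → Adj G u v → (p : PathOf P v x) → (∀ i → u ≢ at p i) → PathOf P u x
  cons {P = P} {u = u} pu u~v p fresh = record
    { len = suc (len p) ; at = f ; start = refl ; end = end p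
    ; injective = inj _ _ ; edges = es ; within = ps }
    where
    f : Fin (suc (suc (len p))) → V
    f zero    = u
    f (suc i) = at p i
    inj : ∀ i j → f i ≡ f j → i ≡ j
    inj zero    zero    _  = refl
    inj zero    (suc j) eq = ⊥-elim (fresh j eq)
    inj (suc i) zero    eq = ⊥-elim (fresh i (sym eq))
    inj (suc i) (suc j) eq = cong suc (injective p eq)
    es : ∀ i → Adj G (f (inject₁ i)) (f (suc i))
    es zero    = subst (Adj G u) (sym (start p)) u~v
    es (suc i) = edges p i
    ps : ∀ i → P (f i)
    ps zero    = pu
    ps (suc i) = within p i

  loopErase : WalkWithin G P u v → PathOf P u v
  loopErase {u = u} (here pu) = record
    { len = 0 ; at = λ _ → u ; start = refl ; end = refl
    ; injective = λ { {zero} {zero} _ → refl } ; edges = λ () ; within = λ _ → pu }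
  loopErase {P = P} {u = u} {v = v} (step pu u~w wk) with loopErase wk
  ... | p with any? (λ i → u ≟F at p i)
  -- `u` already lies on the path of the tail; the loop back to it is dropped.
  ...   | yes (i , eq) = subst (λ z → PathOf P z v) (sym eq) (suffix p i)
  ...   | no  fresh    = cons pu u~w p (λ i eq → fresh (i , eq))

  -- Loop erasure leaves a simple path from b to c that misses a; with a in front it closes up
  -- through the edge from c to a. As b ≢ c, the cycle has at least three vertices.
  closeCycle : ∀ {a b c} → Adj G a b → Adj G c a → b ≢ c →
    WalkWithin G (_≢ a) b c → HasCycle G
  closeCycle {a} a~b c~a b≢c wk with loopErase wk
  ... | record { len = zero ; start = s ; end = e } = ⊥-elim (b≢c (trans (sym s) e))
  ... | p@record { len = suc l } =
    l , at q , injective q , edges q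
      , subst (λ z → Adj G z a) (sym (end p)) c~a
    where q = cons {P = λ _ → ⊤} tt a~b (record
                { len = suc l ; at = at p ; start = start p ; end = end p
                ; injective = injective p ; edges = edges p ; within = λ _ → tt })
                (λ i eq → within p i (sym eq))

-- Building a tree by attaching one node at a time.

module Growth (T : Graph) (isTree : IsTree T) where
  open Walks T

  open DecMembership (_≟F_ {n T}) using () renaming (_∈?_ to _∈ᴸ?_)

  private V = Fin (n T)

  -- Read from the head, the list is an order for stripping the tree: `b` hangs on the remaining
  -- nodes by its edge to `a`. That it behaves like a leaf follows from acyclicity, in
  -- `runningIntersection`.
  data Grown : List V → Set where
    root : ∀ r → Grown (r ∷ [])
    grow : ∀ {a b L} → a ∈ L → b ∉ L → Adj T a b → Grown L → Grown (b ∷ L)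

  grown-connected : ∀ {L x y} → Grown L → x ∈ L → y ∈ L → WalkWithin T (_∈ L) x y
  grown-connected (root r) (here refl) (here refl) = here (here refl)
  grown-connected (grow a∈L _ a~b g) (here refl) (here refl) = here (here refl)
  grown-connected (grow a∈L _ a~b g) (here refl) (there y∈L) =
    step (here refl) (symm T a~b) (mapWalk there (grown-connected g a∈L y∈L))
  grown-connected (grow a∈L _ a~b g) (there x∈L) (here refl) =
    mapWalk there (grown-connected g x∈L a∈L) ++ʷ step (there a∈L) a~b (here (here refl))
  grown-connected (grow a∈L _ a~b g) (there x∈L) (there y∈L) =
    mapWalk there (grown-connected g x∈L y∈L)

  Extends : List V → V → Set
  Extends L y = ∃[ L′ ] Grown L′ × (∀ {z} → z ∈ L → z ∈ L′) × y ∈ L′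

  -- Along the walk the predecessor of each new node is already in the list, so the node can be
  -- attached to it.
  absorb : ∀ {L x y} → Grown L → x ∈ L → WalkWithin T (λ _ → ⊤) x y → Extends L y
  absorb g x∈L (here _) = _ , g , (λ z∈L → z∈L) , x∈L
  absorb {L} g x∈L (step {w = z} _ x~z wk) with z ∈ᴸ? L
  ... | yes z∈L = absorb g z∈L wk
  ... | no  z∉L with absorb (grow x∈L z∉L x~z g) (here refl) wk
  ...   | L′ , g′ , sub , y∈L′ = L′ , g′ , (λ z∈L → sub (there z∈L)) , y∈L′

  absorbAll : ∀ {L r} → Grown L → r ∈ L → (ys : List V) →
    ∃[ L′ ] Grown L′ × r ∈ L′ × All (_∈ L′) ys
  absorbAll g r∈L [] = _ , g , r∈L , []
  absorbAll {r = r} g r∈L (y ∷ ys) with absorbAll g r∈L ys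
  ... | L₁ , g₁ , r∈L₁ , all₁ with absorb g₁ r∈L₁ (proj₁ (proj₂ isTree) r y)
  ...   | L₂ , g₂ , sub , y∈L₂ = L₂ , g₂ , sub r∈L₁ , y∈L₂ ∷ All.map sub all₁

  spanning : V → ∃[ L ] Grown L × (∀ x → x ∈ L)
  spanning r with absorbAll (root r) (here refl) (allFin (n T))
  ... | L , g , _ , all = L , g , λ x → All.lookup all (∈-allFin x)

  -- A walk from the new leaf b to s ∈ L avoiding the parent a, continued
  -- inside L to a neighbour of a, would close a cycle through a and b.
  runningIntersection : ∀ {N a b L s v} (bag : V → Subset N) →
    (∀ v x y → v ∈ˢ bag x → v ∈ˢ bag y → WalkWithin T (λ z → v ∈ˢ bag z) x y) →
    Grown L → a ∈ L → b ∉ L → Adj T a b → s ∈ L →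
    v ∈ˢ bag b → v ∈ˢ bag s → v ∈ˢ bag a
  runningIntersection {a = a} {b} {s = s} {v} bag coherent g a∈L b∉L a~b s∈L v∈b v∈s
    with v ∈? bag a
  ... | yes v∈a = v∈a
  ... | no  v∉a =
    let avoids : ∀ {z} → v ∈ˢ bag z → z ≢ a
        avoids v∈z z≡a = v∉a (subst (λ z → v ∈ˢ bag z) z≡a v∈z)
        c , c~a , c∈L , wk = untilFirst a (avoids v∈s) (grown-connected g s∈L a∈L)
    in ⊥-elim (proj₂ (proj₂ isTree) (closeCycle a~b c~a (λ { refl → b∉L c∈L })
         (mapWalk avoids (coherent v b s v∈b v∈s) ++ʷ mapWalk proj₂ wk)))

-- Differences and cardinalities of finite subsets.

infixl 6 _∖_
_∖_ : ∀ {N} → Subset N → Subset N → Subset N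
p ∖ q = p ∩ ∁ q

module _ {N : ℕ} where

  x∈p∖q⁺ : ∀ {p q : Subset N} {x} → x ∈ˢ p → x ∉ˢ q → x ∈ˢ p ∖ q
  x∈p∖q⁺ x∈p x∉q = x∈p∩q⁺ (x∈p , x∉p⇒x∈∁p x∉q)

  x∈p∖q⁻ : ∀ (p q : Subset N) {x} → x ∈ˢ p ∖ q → x ∈ˢ p × x ∉ˢ q
  x∈p∖q⁻ p q x∈ with x∈p∩q⁻ p (∁ q) x∈
  ... | x∈p , x∈∁q = x∈p , x∈∁p⇒x∉p x∈∁q

∣p∪q∣≤∣p∣+∣q∣ : ∀ {N} (p q : Subset N) → ∣ p ∪ q ∣ ≤ ∣ p ∣ + ∣ q ∣
∣p∪q∣≤∣p∣+∣q∣ []          []          = z≤n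
∣p∪q∣≤∣p∣+∣q∣ (false ∷ p) (false ∷ q) = ∣p∪q∣≤∣p∣+∣q∣ p q
∣p∪q∣≤∣p∣+∣q∣ (false ∷ p) (true ∷ q)  =
  ≤-trans (s≤s (∣p∪q∣≤∣p∣+∣q∣ p q)) (≤-reflexive (sym (+-suc ∣ p ∣ ∣ q ∣)))
∣p∪q∣≤∣p∣+∣q∣ (true ∷ p)  (false ∷ q) = s≤s (∣p∪q∣≤∣p∣+∣q∣ p q)
∣p∪q∣≤∣p∣+∣q∣ (true ∷ p)  (true ∷ q)  =
  s≤s (≤-trans (∣p∪q∣≤∣p∣+∣q∣ p q) (+-monoʳ-≤ ∣ p ∣ (n≤1+n ∣ q ∣)))

∣p∩q∣+∣p∖q∣≡∣p∣ : ∀ {N} (p q : Subset N) → ∣ p ∩ q ∣ + ∣ p ∖ q ∣ ≡ ∣ p ∣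
∣p∩q∣+∣p∖q∣≡∣p∣ []          []          = refl
∣p∩q∣+∣p∖q∣≡∣p∣ (false ∷ p) (_ ∷ q)     = ∣p∩q∣+∣p∖q∣≡∣p∣ p q
∣p∩q∣+∣p∖q∣≡∣p∣ (true ∷ p)  (true ∷ q)  = cong suc (∣p∩q∣+∣p∖q∣≡∣p∣ p q)
∣p∩q∣+∣p∖q∣≡∣p∣ (true ∷ p)  (false ∷ q) =
  trans (+-suc ∣ p ∩ q ∣ ∣ p ∖ q ∣) (cong suc (∣p∩q∣+∣p∖q∣≡∣p∣ p q))

∣p∣≤∣q∣+∣r∣ : ∀ {N} {p : Subset N} (q r : Subset N) →
  (∀ {x} → x ∈ˢ p → x ∈ˢ q ⊎ x ∈ˢ r) → ∣ p ∣ ≤ ∣ q ∣ + ∣ r ∣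
∣p∣≤∣q∣+∣r∣ q r split =
  ≤-trans (p⊆q⇒∣p∣≤∣q∣ (λ x∈p → x∈p∪q⁺ (split x∈p))) (∣p∪q∣≤∣p∣+∣q∣ q r)

2*-split : ∀ {x} y z → x ≤ y + z → 2 * x ≤ 2 * y + 2 * z
2*-split y z x≤ = ≤-trans (*-monoʳ-≤ 2 x≤) (≤-reflexive (*-distribˡ-+ 2 y z))

-- Contracting the decomposition tree to find a cut.

module Elimination
  (T : Graph) (isTree : IsTree T) {N : ℕ} (bag : Fin (n T) → Subset N)
  (coherent : ∀ v x y → v ∈ˢ bag x → v ∈ˢ bag y → WalkWithin T (λ z → v ∈ˢ bag z) x y)
  (c : ℕ) (bagSize : ∀ x → ∣ bag x ∣ ≤ c)
  (vertexCov : ∀ v → ∃ λ x → v ∈ˢ bag x)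
  where

  open Growth T isTree

  private
    V = Fin (n T)

  infix 4 _~_
  -- Sharing a bag stands in for adjacency: edges of the decomposed graph satisfy it by `edgeCov`,
  -- so separating for this relation separates the graph.
  _~_ : Fin N → Fin N → Set
  u ~ v = ∃ λ x → u ∈ˢ bag x × v ∈ˢ bag x

  ~-sym : ∀ {u v} → u ~ v → v ~ u
  ~-sym (x , u∈x , v∈x) = x , v∈x , u∈x

  -- Only the part of `piece` inside A is weighed, while closure concerns the whole piece. Weights
  -- are doubled to avoid halves.
  record Cut (A : Subset N) (lo hi : ℕ) : Set where
    field
      node   : V
      piece  : Subset N
      closed : ∀ {u v} → u ∈ˢ piece → u ~ v → v ∈ˢ piece ⊎ v ∈ˢ bag node
      avoids : ∀ {u} → u ∈ˢ piece → u ∉ˢ bag node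
      lower  : lo ≤ 2 * ∣ A ∩ piece ∣
      upper  : 2 * ∣ A ∩ piece ∣ ≤ hi

  -- The nodes outside L have been contracted into L; W x collects the bags
  -- of the nodes contracted into x.
  record Territories (L : List V) (W : V → Subset N) : Set where
    field
      located  : ∀ {u v} → u ~ v → ∃[ y ] y ∈ L × u ∈ˢ W y × v ∈ˢ W y
      boundary : ∀ {u x y} → x ∈ L → y ∈ L → x ≢ y → u ∈ˢ W x → u ∈ˢ W y → u ∈ˢ bag x

  open Territories

  module _ (W : V → Subset N) (a b : V) where

    contract : V → Subset N
    contract x with x ≟F a
    ... | yes _ = W x ∪ W b
    ... | no  _ = W x

    contract⁻ : ∀ x {u} → u ∈ˢ contract x → u ∈ˢ W x ⊎ (x ≡ a × u ∈ˢ W b)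
    contract⁻ x u∈ with x ≟F a
    ... | no  _   = inj₁ u∈
    ... | yes x≡a with x∈p∪q⁻ (W x) (W b) u∈
    ...   | inj₁ u∈x = inj₁ u∈x
    ...   | inj₂ u∈b = inj₂ (x≡a , u∈b)

    W⊆contract : ∀ x {u} → u ∈ˢ W x → u ∈ˢ contract x
    W⊆contract x u∈ with x ≟F a
    ... | no  _ = u∈
    ... | yes _ = p⊆p∪q (W b) u∈

    Wb⊆contract-a : ∀ {u} → u ∈ˢ W b → u ∈ˢ contract a
    Wb⊆contract-a u∈ with a ≟F a
    ... | yes _   = q⊆p∪q (W a) (W b) u∈
    ... | no  a≢a = ⊥-elim (a≢a refl)

  -- A vertex of both `W b` and `W y`, with y in L, lies in the bags of b and y, hence in that of a
  -- by running intersection. So `boundary` survives at the merged node.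
  contract-territories : ∀ {a b L W} → Grown L → a ∈ L → b ∉ L → Adj T a b →
    Territories (b ∷ L) W → Territories L (contract W a b)
  contract-territories {a} {b} {L} {W} g a∈L b∉L a~b ter = record
    { located = located′ ; boundary = boundary′ }
    where
    W′ = contract W a b
    located′ : ∀ {u v} → u ~ v → ∃[ y ] y ∈ L × u ∈ˢ W′ y × v ∈ˢ W′ y
    located′ u~v with located ter u~v
    ... | .b , here refl , u∈ , v∈ = a , a∈L , Wb⊆contract-a W a b u∈ , Wb⊆contract-a W a b v∈
    ... | y , there y∈L , u∈ , v∈ = y , y∈L , W⊆contract W a b y u∈ , W⊆contract W a b y v∈
    shared : ∀ {u y} → y ∈ L → u ∈ˢ W b → u ∈ˢ W y → u ∈ˢ bag a × u ∈ˢ bag y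
    shared y∈L u∈b u∈y =
      let b≢y = λ { refl → b∉L y∈L }
          u∈bag-y = boundary ter (there y∈L) (here refl) (λ e → b≢y (sym e)) u∈y u∈b
      in runningIntersection bag coherent g a∈L b∉L a~b y∈L
           (boundary ter (here refl) (there y∈L) b≢y u∈b u∈y) u∈bag-y
         , u∈bag-y
    boundary′ : ∀ {u x y} → x ∈ L → y ∈ L → x ≢ y → u ∈ˢ W′ x → u ∈ˢ W′ y → u ∈ˢ bag x
    boundary′ {x = x} {y} x∈L y∈L x≢y u∈x u∈y
      with contract⁻ W a b x u∈x | contract⁻ W a b y u∈y
    ... | inj₁ p          | inj₁ q          = boundary ter (there x∈L) (there y∈L) x≢y p q
    ... | inj₁ p          | inj₂ (_ , q)    = proj₂ (shared x∈L q p)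
    ... | inj₂ (refl , p) | inj₁ q          = proj₁ (shared y∈L p q)
    ... | inj₂ (refl , _) | inj₂ (refl , _) = ⊥-elim (x≢y refl)

  -- A vertex of `W a` outside `bag a` lies in no other territory, so the node locating u and v
  -- together is a itself.
  closed-at : ∀ {L W a} → Territories L W → a ∈ L →
    ∀ {u v} → u ∈ˢ W a ∖ bag a → u ~ v → v ∈ˢ W a ∖ bag a ⊎ v ∈ˢ bag a
  closed-at {W = W} {a} ter a∈L {v = v} u∈ u~v
    with x∈p∖q⁻ (W a) (bag a) u∈ | located ter u~v
  ... | u∈Wa , u∉a | y , y∈L , u∈y , v∈y with a ≟F y
  ...   | no  a≢y  = ⊥-elim (u∉a (boundary ter a∈L y∈L a≢y u∈Wa u∈y))
  ...   | yes refl with v ∈? bag a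
  ...     | yes v∈a = inj₂ v∈a
  ...     | no  v∉a = inj₁ (x∈p∖q⁺ v∈y v∉a)

  -- If u and v were located together at some y in L, then u would lie in the bags of b and y, hence
  -- in `bag a`.
  closed-leaf : ∀ {L W a b} → Grown L → a ∈ L → b ∉ L → Adj T a b → Territories (b ∷ L) W →
    ∀ {u v} → u ∈ˢ W b ∖ bag a → u ~ v → v ∈ˢ W b ∖ bag a ⊎ v ∈ˢ bag a
  closed-leaf {W = W} {a} {b} g a∈L b∉L a~b ter {v = v} u∈ u~v
    with x∈p∖q⁻ (W b) (bag a) u∈ | located ter u~v
  ... | u∈Wb , u∉a | y , there y∈L , u∈y , _ =
    ⊥-elim (u∉a (runningIntersection bag coherent g a∈L b∉L a~b y∈L
      (boundary ter (here refl) (there y∈L) (λ { refl → b∉L y∈L }) u∈Wb u∈y)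
      (boundary ter (there y∈L) (here refl) (λ { refl → b∉L y∈L }) u∈y u∈Wb)))
  ... | _ | .b , here refl , _ , v∈y with v ∈? bag a
  ...     | yes v∈a = inj₂ v∈a
  ...     | no  v∉a = inj₁ (x∈p∖q⁺ v∈y v∉a)

  -- Weights below `lo` are at most lo - 1; adding twice a bag, or another such weight, stays within
  -- `hi`. `heavy` ensures that the contraction cannot end without a cut.
  module _ (A : Subset N) (lo hi : ℕ)
    (bag-step : lo + 2 * c ≤ suc hi) (merge-step : lo + lo ≤ 2 + hi) (heavy : hi < 2 * ∣ A ∣)
    where

    Small : Subset N → Set
    Small p = 2 * ∣ A ∩ p ∣ < lo

    small+bag : ∀ {p x} → Small p → 2 * ∣ A ∩ p ∣ + 2 * ∣ bag x ∣ ≤ hi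
    small+bag {p} {x} small = s≤s⁻¹ (≤-trans
      (+-mono-≤ small (*-monoʳ-≤ 2 (bagSize x))) bag-step)

    small+small : ∀ {p q} → Small p → Small q → 2 * ∣ A ∩ p ∣ + 2 * ∣ A ∩ q ∣ ≤ hi
    small+small {p} {q} sp sq = s≤s⁻¹ (s≤s⁻¹ (≤-trans
      (≤-reflexive (cong suc (sym (+-suc (2 * ∣ A ∩ p ∣) (2 * ∣ A ∩ q ∣)))))
      (≤-trans (+-mono-≤ sp sq) merge-step)))

    -- One contraction step enlarges a small piece by a bag or by another small
    -- piece, so the weight cannot jump over the window [lo , hi].
    eliminate : ∀ {L W} → Grown L → Territories L W →
      (∀ {x} → x ∈ L → Small (W x ∖ bag x)) → Cut A lo hi
    -- Only the root is left, so `W r` is everything, and A would weigh at most `hi`.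
    eliminate {W = W} (root r) ter small = ⊥-elim (<⇒≱ heavy (≤-trans
      (2*-split ∣ A ∩ (W r ∖ bag r) ∣ ∣ bag r ∣ (∣p∣≤∣q∣+∣r∣ (A ∩ (W r ∖ bag r)) (bag r) split))
      (small+bag {W r ∖ bag r} (small (here refl)))))
      where
      split : ∀ {x} → x ∈ˢ A → x ∈ˢ A ∩ (W r ∖ bag r) ⊎ x ∈ˢ bag r
      split {x} x∈A with located ter (let y , x∈y = vertexCov x in y , x∈y , x∈y) | x ∈? bag r
      ... | _                       | yes x∈r = inj₂ x∈r
      ... | .r , here refl , x∈W , _ | no x∉r  = inj₁ (x∈p∩q⁺ (x∈A , x∈p∖q⁺ x∈W x∉r))
    eliminate {b ∷ L} {W} (grow {a = a} a∈L b∉L a~b g) ter small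
      -- First candidate: the leaf cut off by its parent's bag. Compared with the small set W b ∖
      -- bag b, it gains only vertices of `bag b`.
      with 2 * ∣ A ∩ (W b ∖ bag a) ∣ <? lo
    ... | no ¬small = record
      { node = a ; piece = W b ∖ bag a
      ; closed = closed-leaf g a∈L b∉L a~b ter
      ; avoids = λ u∈ → proj₂ (x∈p∖q⁻ (W b) (bag a) u∈)
      ; lower = ≮⇒≥ ¬small
      ; upper = ≤-trans
          (2*-split ∣ A ∩ (W b ∖ bag b) ∣ ∣ bag b ∣ (∣p∣≤∣q∣+∣r∣ (A ∩ (W b ∖ bag b)) (bag b) split))
          (small+bag {W b ∖ bag b} (small (here refl))) }
      where
      split : ∀ {x} → x ∈ˢ A ∩ (W b ∖ bag a) → x ∈ˢ A ∩ (W b ∖ bag b) ⊎ x ∈ˢ bag b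
      split {x} x∈ with x∈p∩q⁻ A (W b ∖ bag a) x∈ | x ∈? bag b
      ... | _         | yes x∈b = inj₂ x∈b
      ... | x∈A , x∈Q | no  x∉b =
        inj₁ (x∈p∩q⁺ (x∈A , x∈p∖q⁺ (proj₁ (x∈p∖q⁻ (W b) (bag a) x∈Q)) x∉b))
    -- Second candidate: the merged territory at a, the union of two small sets.
    ... | yes small-leaf with 2 * ∣ A ∩ (contract W a b a ∖ bag a) ∣ <? lo
    ...   | no ¬small = record
      { node = a ; piece = contract W a b a ∖ bag a
      ; closed = closed-at (contract-territories g a∈L b∉L a~b ter) a∈L
      ; avoids = λ u∈ → proj₂ (x∈p∖q⁻ (contract W a b a) (bag a) u∈)
      ; lower = ≮⇒≥ ¬small
      ; upper = ≤-trans
          (2*-split ∣ A ∩ (W a ∖ bag a) ∣ ∣ A ∩ (W b ∖ bag a) ∣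
            (∣p∣≤∣q∣+∣r∣ (A ∩ (W a ∖ bag a)) (A ∩ (W b ∖ bag a)) split))
          (small+small {W a ∖ bag a} {W b ∖ bag a} (small (there a∈L)) small-leaf) }
      where
      split : ∀ {x} → x ∈ˢ A ∩ (contract W a b a ∖ bag a) →
        x ∈ˢ A ∩ (W a ∖ bag a) ⊎ x ∈ˢ A ∩ (W b ∖ bag a)
      split {x} x∈ with x∈p∩q⁻ A (contract W a b a ∖ bag a) x∈
      ... | x∈A , x∈Q with x∈p∖q⁻ (contract W a b a) (bag a) x∈Q
      ...   | x∈W′ , x∉a with contract⁻ W a b a x∈W′
      ...     | inj₁ x∈a       = inj₁ (x∈p∩q⁺ (x∈A , x∈p∖q⁺ x∈a x∉a))
      ...     | inj₂ (_ , x∈b) = inj₂ (x∈p∩q⁺ (x∈A , x∈p∖q⁺ x∈b x∉a))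
    -- Neither candidate reaches `lo`, so all territories are still small after the contraction.
    ...   | yes small-a =
      eliminate g (contract-territories g a∈L b∉L a~b ter) small′
      where
      small′ : ∀ {x} → x ∈ L → Small (contract W a b x ∖ bag x)
      small′ {x} x∈L = compare (x ≟F a)
        where
        compare : Dec (x ≡ a) → Small (contract W a b x ∖ bag x)
        compare (yes refl) = small-a
        compare (no x≢a)   = ≤-<-trans (*-monoʳ-≤ 2 (p⊆q⇒∣p∣≤∣q∣ shrink)) (small (there x∈L))
          where
          shrink : A ∩ (contract W a b x ∖ bag x) ⊆ A ∩ (W x ∖ bag x)
          shrink u∈ with x∈p∩q⁻ A (contract W a b x ∖ bag x) u∈
          ... | u∈A , u∈Q with x∈p∖q⁻ (contract W a b x) (bag x) u∈Q
          ...   | u∈W′ , u∉x with contract⁻ W a b x u∈W′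
          ...     | inj₁ u∈W       = x∈p∩q⁺ (u∈A , x∈p∖q⁺ u∈W u∉x)
          ...     | inj₂ (x≡a , _) = ⊥-elim (x≢a x≡a)

    -- At the start each territory is its own bag, so W x ∖ bag x is empty and thus small.
    cut : V → 0 < lo → Cut A lo hi
    cut r 0<lo = let L , g , all = spanning r in
      eliminate {W = bag} g
        (record { located = λ { (x , u∈ , v∈) → x , all x , u∈ , v∈ }
                ; boundary = λ _ _ _ u∈x _ → u∈x })
        (λ {x} _ → ≤-<-trans (*-monoʳ-≤ 2 (empty x)) 0<lo)
      where
      empty : ∀ x → ∣ A ∩ (bag x ∖ bag x) ∣ ≤ 0
      empty x = ≤-trans (p⊆q⇒∣p∣≤∣q∣ vacuous) (≤-reflexive (∣⊥∣≡0 N))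
        where
        vacuous : A ∩ (bag x ∖ bag x) ⊆ ∅
        vacuous u∈ with x∈p∖q⁻ (bag x) (bag x) (proj₂ (x∈p∩q⁻ A (bag x ∖ bag x) u∈))
        ... | u∈x , u∉x = ⊥-elim (u∉x u∈x)

-- Arithmetic of moving a piece from side a to side b, where f is the excess of 2a over s + e.

module Balancing {a b s e f : ℕ} (2a≡ : 2 * a ≡ s + e + f) (a+b≤s : a + b ≤ s) where

  open ≤-Reasoning

  -- The bound 2 + 3e on the old slack is what makes f + f ≤ 2 + (f + 2e), the merge condition for
  -- the window [f , f + 2e].
  f≤2+2e : 2 * a ≤ s + (2 + 3 * e) → f ≤ 2 + 2 * e
  f≤2+2e 2a≤ = +-cancelˡ-≤ (s + e) f (2 + 2 * e) (begin
    s + e + f            ≡⟨ 2a≡ ⟨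
    2 * a                ≤⟨ 2a≤ ⟩
    s + (2 + 3 * e)      ≡⟨ spread s e ⟩
    s + e + (2 + 2 * e)  ∎)
    where
    spread : ∀ x y → x + (2 + 3 * y) ≡ x + y + (2 + 2 * y)
    spread = solve-∀

  e<s : 0 < f → e < s
  e<s 0<f = +-cancelˡ-< s e s (begin-strict
    s + e        <⟨ m<m+n (s + e) 0<f ⟩
    s + e + f    ≡⟨ 2a≡ ⟨
    2 * a        ≤⟨ *-monoʳ-≤ 2 (m+n≤o⇒m≤o a a+b≤s) ⟩
    2 * s        ≡⟨ cong (s +_) (+-identityʳ s) ⟩
    s + s        ∎)

  -- The `heavy` condition for the window [f , f + 2e].
  f+2e<2a : 0 < f → f + 2 * e < 2 * a
  f+2e<2a 0<f = begin-strict
    f + 2 * e      ≡⟨ bump f e ⟩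
    e + (e + f)    <⟨ +-monoˡ-< (e + f) (e<s 0<f) ⟩
    s + (e + f)    ≡⟨ +-assoc s e f ⟨
    s + e + f      ≡⟨ 2a≡ ⟨
    2 * a          ∎
    where
    bump : ∀ x y → x + 2 * y ≡ y + (y + x)
    bump = solve-∀

  -- The lower end of the window: taking 2m ≥ f off 2a removes the excess.
  shrunk : ∀ {m a′} → f ≤ 2 * m → m + a′ ≤ a → 2 * a′ ≤ s + e
  shrunk {m} {a′} f≤2m m+a′≤a = +-cancelˡ-≤ f (2 * a′) (s + e) (begin
    f + 2 * a′        ≤⟨ +-monoˡ-≤ (2 * a′) f≤2m ⟩
    2 * m + 2 * a′    ≡⟨ *-distribˡ-+ 2 m a′ ⟨
    2 * (m + a′)      ≤⟨ *-monoʳ-≤ 2 m+a′≤a ⟩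
    2 * a             ≡⟨ 2a≡ ⟩
    s + e + f         ≡⟨ +-comm (s + e) f ⟩
    f + (s + e)       ∎)

  -- The upper end of the window: b ≤ s - a gives 2(b + m) ≤ 2s - 2a + f + 2e = s + e.
  grown : ∀ {m b′} → 2 * m ≤ f + 2 * e → b′ ≤ b + m → 2 * b′ ≤ s + e
  grown {m} {b′} 2m≤ b′≤ = +-cancelˡ-≤ (s + e + f) (2 * b′) (s + e) (begin
    s + e + f + 2 * b′              ≤⟨ +-monoʳ-≤ (s + e + f) (*-monoʳ-≤ 2 b′≤) ⟩
    s + e + f + 2 * (b + m)         ≡⟨ cong (s + e + f +_) (*-distribˡ-+ 2 b m) ⟩
    s + e + f + (2 * b + 2 * m)     ≤⟨ +-monoʳ-≤ (s + e + f) (+-monoʳ-≤ (2 * b) 2m≤) ⟩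
    s + e + f + (2 * b + (f + 2 * e)) ≡⟨ cong (_+ (2 * b + (f + 2 * e))) 2a≡ ⟨
    2 * a + (2 * b + (f + 2 * e))   ≡⟨ collect a b (f + 2 * e) ⟩
    2 * (a + b) + (f + 2 * e)       ≤⟨ +-monoˡ-≤ (f + 2 * e) (*-monoʳ-≤ 2 a+b≤s) ⟩
    2 * s + (f + 2 * e)             ≡⟨ regroup s e f ⟩
    s + e + f + (s + e)             ∎)
    where
    collect : ∀ x y z → 2 * x + (2 * y + z) ≡ 2 * (x + y) + z
    collect = solve-∀
    regroup : ∀ x y z → 2 * x + (z + 2 * y) ≡ x + y + z + (x + y)
    regroup = solve-∀

-- Balanced separations by j bags.

module Separation
  (T : Graph) (isTree : IsTree T) {N : ℕ} (bag : Fin (n T) → Subset N)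
  (coherent : ∀ v x y → v ∈ˢ bag x → v ∈ˢ bag y → WalkWithin T (λ z → v ∈ˢ bag z) x y)
  (c : ℕ) (bagSize : ∀ x → ∣ bag x ∣ ≤ c)
  (vertexCov : ∀ v → ∃ λ x → v ∈ˢ bag x)
  (r : Fin (n T))
  where

  open Elimination T isTree bag coherent c bagSize vertexCov public

  record Separation (S : Subset N) (j e : ℕ) : Set where
    field
      A B X  : Subset N
      A+B≤S  : ∣ A ∣ + ∣ B ∣ ≤ ∣ S ∣
      A-size : 2 * ∣ A ∣ ≤ ∣ S ∣ + e
      B-size : 2 * ∣ B ∣ ≤ ∣ S ∣ + e
      X-size : ∣ X ∣ ≤ j * c
      covers : ∀ {v} → v ∈ˢ S → v ∈ˢ A ⊎ v ∈ˢ B ⊎ v ∈ˢ X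
      apart  : ∀ {u v} → u ∈ˢ A → v ∈ˢ B → ¬ u ~ v

  open Separation

  swap : ∀ {S j e} → Separation S j e → Separation S j e
  swap s = record
    { A = B s ; B = A s ; X = X s
    ; A+B≤S = ≤-trans (≤-reflexive (+-comm ∣ B s ∣ ∣ A s ∣)) (A+B≤S s)
    ; A-size = B-size s ; B-size = A-size s ; X-size = X-size s
    ; covers = λ v∈S → [ (λ p → inj₂ (inj₁ p)) , [ inj₁ , (λ p → inj₂ (inj₂ p)) ]′ ]′ (covers s v∈S)
    ; apart = λ u∈ v∈ u~v → apart s v∈ u∈ (~-sym u~v) }

  trivial : ∀ S → Separation S 0 ∣ S ∣
  trivial S = record
    { A = S ; B = ∅ ; X = ∅
    ; A+B≤S = ≤-reflexive (trans (cong (∣ S ∣ +_) (∣⊥∣≡0 N)) (+-identityʳ ∣ S ∣))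
    ; A-size = ≤-reflexive (cong (∣ S ∣ +_) (+-identityʳ ∣ S ∣))
    ; B-size = ≤-trans (≤-reflexive (cong (2 *_) (∣⊥∣≡0 N))) z≤n
    ; X-size = ≤-reflexive (∣⊥∣≡0 N)
    ; covers = inj₁ ; apart = λ _ v∈∅ → ⊥-elim (∉⊥ v∈∅) }

  -- Elements related to `piece` lie in `piece` or in the bag of `node`. The new first side omits
  -- both, so it stays apart from the part moved across.
  transfer : ∀ {S j e f} (s : Separation S j (2 + 3 * e)) →
    2 * ∣ A s ∣ ≡ ∣ S ∣ + e + f → Cut (A s) f (f + 2 * e) → Separation S (suc j) e
  transfer {S} {j} {e} {f} s 2A≡ κ = record
    { A = A′ ; B = B s ∪ M ; X = X s ∪ bag node
    ; A+B≤S = total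
    ; A-size = shrunk {m = ∣ M ∣} {a′ = ∣ A′ ∣} lower M+A′≤A
    ; B-size = grown {m = ∣ M ∣} {b′ = ∣ B s ∪ M ∣} upper (∣p∪q∣≤∣p∣+∣q∣ (B s) M)
    ; X-size = ≤-trans (∣p∪q∣≤∣p∣+∣q∣ (X s) (bag node)) (≤-trans
        (≤-reflexive (+-comm ∣ X s ∣ ∣ bag node ∣)) (+-mono-≤ (bagSize node) (X-size s)))
    ; covers = covers′ ; apart = apart′ }
    where
    open Balancing {a = ∣ A s ∣} {b = ∣ B s ∣} {s = ∣ S ∣} {e = e} {f = f} 2A≡ (A+B≤S s)
    open Cut κ
    M A′ : Subset N
    M  = A s ∩ piece
    A′ = A s ∖ (piece ∪ bag node)
    M+A′≤A : ∣ M ∣ + ∣ A′ ∣ ≤ ∣ A s ∣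
    M+A′≤A = ≤-trans (+-monoʳ-≤ ∣ M ∣ (p⊆q⇒∣p∣≤∣q∣ fewer))
      (≤-reflexive (∣p∩q∣+∣p∖q∣≡∣p∣ (A s) piece))
      where
      fewer : A′ ⊆ A s ∖ piece
      fewer u∈ with x∈p∖q⁻ (A s) (piece ∪ bag node) u∈
      ... | u∈A , u∉ = x∈p∖q⁺ u∈A (λ u∈p → u∉ (x∈p∪q⁺ (inj₁ u∈p)))
    total : ∣ A′ ∣ + ∣ B s ∪ M ∣ ≤ ∣ S ∣
    total = begin
      ∣ A′ ∣ + ∣ B s ∪ M ∣         ≤⟨ +-monoʳ-≤ ∣ A′ ∣ (∣p∪q∣≤∣p∣+∣q∣ (B s) M) ⟩
      ∣ A′ ∣ + (∣ B s ∣ + ∣ M ∣)   ≡⟨ +-comm ∣ A′ ∣ _ ⟩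
      ∣ B s ∣ + ∣ M ∣ + ∣ A′ ∣     ≡⟨ +-assoc ∣ B s ∣ _ _ ⟩
      ∣ B s ∣ + (∣ M ∣ + ∣ A′ ∣)   ≤⟨ +-monoʳ-≤ ∣ B s ∣ M+A′≤A ⟩
      ∣ B s ∣ + ∣ A s ∣            ≡⟨ +-comm ∣ B s ∣ _ ⟩
      ∣ A s ∣ + ∣ B s ∣            ≤⟨ A+B≤S s ⟩
      ∣ S ∣                        ∎
      where open ≤-Reasoning
    covers′ : ∀ {v} → v ∈ˢ S → v ∈ˢ A′ ⊎ v ∈ˢ B s ∪ M ⊎ v ∈ˢ X s ∪ bag node
    covers′ {v} v∈S with covers s v∈S
    ... | inj₂ (inj₁ v∈B) = inj₂ (inj₁ (x∈p∪q⁺ (inj₁ v∈B)))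
    ... | inj₂ (inj₂ v∈X) = inj₂ (inj₂ (x∈p∪q⁺ (inj₁ v∈X)))
    ... | inj₁ v∈A with v ∈? piece | v ∈? bag node
    ...   | yes v∈p | _       = inj₂ (inj₁ (x∈p∪q⁺ (inj₂ (x∈p∩q⁺ (v∈A , v∈p)))))
    ...   | no  _   | yes v∈x = inj₂ (inj₂ (x∈p∪q⁺ (inj₂ v∈x)))
    ...   | no  v∉p | no  v∉x =
      inj₁ (x∈p∖q⁺ v∈A (λ v∈ → [ v∉p , v∉x ]′ (x∈p∪q⁻ piece (bag node) v∈)))
    apart′ : ∀ {u v} → u ∈ˢ A′ → v ∈ˢ B s ∪ M → ¬ u ~ v
    apart′ u∈ v∈ u~v with x∈p∖q⁻ (A s) (piece ∪ bag node) u∈ | x∈p∪q⁻ (B s) M v∈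
    ... | u∈A , _  | inj₁ v∈B = apart s u∈A v∈B u~v
    ... | _   , u∉ | inj₂ v∈M =
      u∉ (x∈p∪q⁺ (closed (proj₂ (x∈p∩q⁻ (A s) piece v∈M)) (~-sym u~v)))

  rebalance : ∀ {S j e} → c ≤ e → (s : Separation S j (2 + 3 * e)) →
    ∣ S ∣ + e < 2 * ∣ A s ∣ → Separation S (suc j) e
  rebalance {S} {e = e} c≤e s A-big with m≤n⇒∃[o]m+o≡n (<⇒≤ A-big)
  ... | zero , eq = ⊥-elim (<⇒≢ A-big (trans (sym (+-identityʳ (∣ S ∣ + e))) eq))
  -- In the window [f , f + 2e], c ≤ e leaves room for one bag.
  ... | f@(suc _) , eq = transfer s (sym eq) (cut (A s) f (f + 2 * e)
      (≤-trans (+-monoʳ-≤ f (*-monoʳ-≤ 2 c≤e)) (n≤1+n _)) merge-step (f+2e<2a 0<f) r 0<f)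
    where
    open Balancing {a = ∣ A s ∣} {b = ∣ B s ∣} {s = ∣ S ∣} {e = e} {f = f} (sym eq) (A+B≤S s)
    0<f : 0 < f
    0<f = s≤s z≤n
    merge-step : f + f ≤ 2 + (f + 2 * e)
    merge-step = ≤-trans (+-monoʳ-≤ f (f≤2+2e (A-size s)))
      (≤-reflexive (trans (+-suc f (suc (2 * e))) (cong suc (+-suc f (2 * e)))))

  refine : ∀ {S j e} → c ≤ e → Separation S j (2 + 3 * e) → Separation S (suc j) e
  refine {S} {j} {e} c≤e s with 2 * ∣ A s ∣ ≤? ∣ S ∣ + e | 2 * ∣ B s ∣ ≤? ∣ S ∣ + e
  ... | no A-big | _        = rebalance c≤e s (≰⇒> A-big)
  ... | yes _    | no B-big = rebalance c≤e (swap s) (≰⇒> B-big)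
  ... | yes A≤   | yes B≤   = record
    { A = A s ; B = B s ; X = X s ; A+B≤S = A+B≤S s ; A-size = A≤ ; B-size = B≤
    ; X-size = ≤-trans (X-size s) (m≤n+m (j * c) c)
    ; covers = covers s ; apart = apart s }

  weaken : ∀ {S j e e′} → e ≤ e′ → Separation S j e → Separation S j e′
  weaken {S} e≤e′ s = record
    { A = A s ; B = B s ; X = X s ; A+B≤S = A+B≤S s
    ; A-size = ≤-trans (A-size s) (+-monoʳ-≤ ∣ S ∣ e≤e′)
    ; B-size = ≤-trans (B-size s) (+-monoʳ-≤ ∣ S ∣ e≤e′)
    ; X-size = X-size s ; covers = covers s ; apart = apart s }

  -- As 3 (e + 1) = (2 + 3e) + 1, the size hypothesis for j + 1 and e is the one for j and 2 + 3e.
  -- At j = 0 it says ∣S∣ ≤ e, and no bag has to be cut.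
  separate : ∀ S j e → c ≤ e → ∣ S ∣ < 3 ^ j * suc e → Separation S j e
  separate S zero    e c≤e S< =
    weaken (s≤s⁻¹ (≤-trans S< (≤-reflexive (*-identityˡ (suc e))))) (trivial S)
  separate S (suc j) e c≤e S< = refine c≤e (separate S j (2 + 3 * e)
    (≤-trans c≤e (≤-trans (m≤n*m e 3) (m≤n+m (3 * e) 2)))
    (subst (∣ S ∣ <_) (triple (3 ^ j) e) S<))
    where
    triple : ∀ x y → 3 * x * suc y ≡ x * suc (2 + 3 * y)
    triple x y = trans (cong (_* suc y) (*-comm 3 x))
      (trans (*-assoc x 3 (suc y)) (cong (x *_) (*-suc 3 y)))

-- Embeddings into cliques and into the join.

index : ∀ {N m} (p : Subset N) → ∣ p ∣ ≤ m → ∀ {v} → v ∈ˢ p → Fin m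
index (true ∷ p)  (s≤s _) here       = zero
index (true ∷ p)  (s≤s l) (there v∈p) = suc (index p l v∈p)
index (false ∷ p) l       (there v∈p) = index p l v∈p

index-injective : ∀ {N m} (p : Subset N) (l : ∣ p ∣ ≤ m) {u v} (u∈ : u ∈ˢ p) (v∈ : v ∈ˢ p) →
  index p l u∈ ≡ index p l v∈ → u ≡ v
index-injective (true ∷ p) (s≤s l) here       here       _  = refl
index-injective (true ∷ p) (s≤s l) (there u∈) (there v∈) eq =
  cong suc (index-injective p l u∈ v∈ (suc-injective eq))
index-injective (false ∷ p) l (there u∈) (there v∈) eq =
  cong suc (index-injective p l u∈ v∈ eq)

-- An embedding of the subgraph induced on S, defined on membership proofs so that S need not be
-- renumbered.
record Embedding (H G : Graph) (S : Subset (n H)) : Set where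
  field
    image     : ∀ {v} → v ∈ˢ S → Fin (n G)
    injective : ∀ {u v} (u∈ : u ∈ˢ S) (v∈ : v ∈ˢ S) → image u∈ ≡ image v∈ → u ≡ v
    preserves : ∀ {u v} (u∈ : u ∈ˢ S) (v∈ : v ∈ˢ S) → Adj H u v → Adj G (image u∈) (image v∈)

open Embedding

embedClique : ∀ {H S} m → ∣ S ∣ ≤ m → Embedding H (K m) S
embedClique {H} {S} m l = record
  { image     = index S l
  ; injective = index-injective S l
  ; preserves = λ u∈ v∈ u~v eq → irrefl H (subst (Adj H _) (sym (index-injective S l u∈ v∈ eq)) u~v) }

place : ∀ {c m} → Part c m → Fin (c + (m + m))
place {c} {m} (clique i) = i ↑ˡ (m + m)
place {c} {m} (left x)   = c ↑ʳ (x ↑ˡ m)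
place {c} {m} (right y)  = c ↑ʳ (m ↑ʳ y)

part-place : ∀ {c m} (a : Part c m) → part c m (place a) ≡ a
part-place {c} {m} (clique i) rewrite splitAt-↑ˡ c i (m + m) = refl
part-place {c} {m} (left x)
  rewrite splitAt-↑ʳ c (m + m) (x ↑ˡ m) | splitAt-↑ˡ m x m = refl
part-place {c} {m} (right y)
  rewrite splitAt-↑ʳ c (m + m) (m ↑ʳ y) | splitAt-↑ʳ m m y = refl

module _ {H G : Graph} {c : ℕ} {S A B X : Subset (n H)} (X≤c : ∣ X ∣ ≤ c)
  (covers : ∀ {v} → v ∈ˢ S → v ∈ˢ A ⊎ v ∈ˢ B ⊎ v ∈ˢ X)
  (apart : ∀ {u v} → u ∈ˢ A → v ∈ˢ B → ¬ Adj H u v)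
  (f : Embedding H G A) (g : Embedding H G B)
  where

  private
    sort : ∀ {v} → v ∈ˢ A ⊎ v ∈ˢ B ⊎ v ∈ˢ X → Part c (n G)
    sort (inj₁ v∈A)        = left (image f v∈A)
    sort (inj₂ (inj₁ v∈B)) = right (image g v∈B)
    sort (inj₂ (inj₂ v∈X)) = clique (index X X≤c v∈X)

    sort-injective : ∀ {u v} (p : u ∈ˢ A ⊎ u ∈ˢ B ⊎ u ∈ˢ X) (q : v ∈ˢ A ⊎ v ∈ˢ B ⊎ v ∈ˢ X) →
      sort p ≡ sort q → u ≡ v
    sort-injective (inj₁ p)        (inj₁ q)        eq = injective f p q (left-inj eq)
      where
      left-inj : ∀ {c m} {x y : Fin m} → left {c} x ≡ left y → x ≡ y
      left-inj refl = refl
    sort-injective (inj₂ (inj₁ p)) (inj₂ (inj₁ q)) eq = injective g p q (right-inj eq)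
      where
      right-inj : ∀ {c m} {x y : Fin m} → right {c} x ≡ right y → x ≡ y
      right-inj refl = refl
    sort-injective (inj₂ (inj₂ p)) (inj₂ (inj₂ q)) eq = index-injective X X≤c p q (clique-inj eq)
      where
      clique-inj : ∀ {c m} {i j : Fin c} → clique {m = m} i ≡ clique j → i ≡ j
      clique-inj refl = refl

    sort-injective (inj₁ _)        (inj₂ (inj₁ _)) ()
    sort-injective (inj₁ _)        (inj₂ (inj₂ _)) ()
    sort-injective (inj₂ (inj₁ _)) (inj₁ _)        ()
    sort-injective (inj₂ (inj₁ _)) (inj₂ (inj₂ _)) ()
    sort-injective (inj₂ (inj₂ _)) (inj₁ _)        ()
    sort-injective (inj₂ (inj₂ _)) (inj₂ (inj₁ _)) ()

    sort-preserves : ∀ {u v} (p : u ∈ˢ A ⊎ u ∈ˢ B ⊎ u ∈ˢ X) (q : v ∈ˢ A ⊎ v ∈ˢ B ⊎ v ∈ˢ X) →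
      Adj H u v → PAdj c G (sort p) (sort q)
    sort-preserves (inj₁ p)        (inj₁ q)        e = preserves f p q e
    sort-preserves (inj₁ p)        (inj₂ (inj₁ q)) e = ⊥-elim (apart p q e)
    sort-preserves (inj₁ p)        (inj₂ (inj₂ q)) e = tt
    sort-preserves (inj₂ (inj₁ p)) (inj₁ q)        e = ⊥-elim (apart q p (symm H e))
    sort-preserves (inj₂ (inj₁ p)) (inj₂ (inj₁ q)) e = preserves g p q e
    sort-preserves (inj₂ (inj₁ p)) (inj₂ (inj₂ q)) e = tt
    sort-preserves (inj₂ (inj₂ p)) (inj₁ q)        e = tt
    sort-preserves (inj₂ (inj₂ p)) (inj₂ (inj₁ q)) e = tt
    sort-preserves (inj₂ (inj₂ p)) (inj₂ (inj₂ q)) e eq =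
      irrefl H (subst (Adj H _) (sym (index-injective X X≤c p q eq)) e)

  -- `covers` decides where a vertex goes. The join lacks edges between parts only from left to
  -- right, and `apart` rules these out in H.
  embedJoin : Embedding H (joinK2 c G) S
  embedJoin = record
    { image = λ v∈ → place (sort (covers v∈))
    ; injective = λ u∈ v∈ eq → sort-injective (covers u∈) (covers v∈)
        (trans (sym (part-place _)) (trans (cong (part c (n G)) eq) (part-place _)))
    ; preserves = λ u∈ v∈ e → subst₂ (PAdj c G) (sym (part-place (sort (covers u∈))))
        (sym (part-place (sort (covers v∈)))) (sort-preserves (covers u∈) (covers v∈) e) }

theorem4p10 : (w k : ℕ) → 1 Data.Nat.≤ k → (pwk : ℕ) → IsPwk w k pwk →
    (p : ℕ) → pwk Data.Nat.≤ p →
    (H : Graph) → TreewidthAtMost H k → toℚ (n H) Data.Rational.≤ gamma w p →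
    Contains (Gwkp w k pwk p) H
theorem4p10 w k _ pwk isPwk p pwk≤p H td n≤γ =
  (λ v → image whole (∈⊤ {x = v})) , (λ {u} {v} → injective whole ∈⊤ ∈⊤)
  , λ u v → preserves whole ∈⊤ ∈⊤
  where
  open TreeDecomposition td
  module Sep = Separation tree isTree bag coherent (suc k) bagSize vertexCov (fromℕ< (proj₁ isTree))
  open Estimates.Weights w k

  -- The induction runs over vertex subsets of the fixed graph H, so that one tree decomposition
  -- serves every recursive call.
  embed : ∀ i (S : Subset (n H)) → toℚ ∣ S ∣ Data.Rational.≤ gamma w (i + pwk) → Embedding H (Gseq w k i) S
  embed zero    S S≤ = embedClique (ceilDelta k w) (base-size isPwk S≤)
  embed (suc i) S S≤ =
    let e , k<e , S< , half≤ = split-size i isPwk S≤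
        s = Sep.separate S (suc w) e k<e S<
        open Sep.Separation s
    in embedJoin (≤-trans X-size (≤-reflexive (*-comm (suc w) (suc k))))
         covers (λ u∈ v∈ u~v → apart u∈ v∈ (edgeCov _ _ u~v))
         (embed i A (half≤ ∣ A ∣ A-size)) (embed i B (half≤ ∣ B ∣ B-size))

  whole : Embedding H (Gseq w k (p ∸ pwk)) full
  whole = embed (p ∸ pwk) full
    (subst₂ (λ s q → toℚ s Data.Rational.≤ gamma w q) (sym (∣⊤∣≡n (n H))) (sym (m∸n+n≡m pwk≤p)) n≤γ)
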